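{- For every odd integer $n\ge 3$, the cycle $C_n$ on $n$ vertices satisfies \[ \underline{\mathrm{lcs}}(C_n)=\begin{cases}\dfrac{n+3}{2} & \text{if } n\equiv 1 \pmod 4,\\[2mm] \dfrac{n+1}{2} & \text{if } n\equiv 3 \pmod 4.\end{cases} \]
   Context: $[k]=\{1,\dots,k\}$ and $\chi(G)$ is the chromatic number of a graph $G=(V,E)$. For a proper coloring $c:V\to[\chi(G)]$, a determining set for $(G,c)$ is a set $S\subseteq V$ such that for every proper coloring $c':V\to[\chi(G)]$ of $G$, if $c'|_S=c|_S$ then $c'=c$ on all of $V$. A critical set for $(G,c)$ is a determining set for $(G,c)$ that is minimal under inclusion. Define $\mathrm{lcs}(G,c)=\max\{|X| : X \text{ is a critical set for } (G,c)\}$ and $\underline{\mathrm{lcs}}(G)=\min_c \mathrm{lcs}(G,c)$, where the minimum is over all proper colorings $c:V\to[\chi(G)]$. -}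

module Defs where

open import Data.Empty using (⊥)
open import Data.Fin using (Fin; toℕ)
open import Data.Fin.Subset using (Subset; _∈_; _⊂_; ∣_∣)
open import Data.Nat using (ℕ; suc; _≤_; s≤s; _≟_)
open import Data.Nat.Properties using (1+n≢n)
open import Data.Product using (∃; _×_; _,_)
open import Data.Sum using (_⊎_; inj₁; inj₂; swap)
open import Level using (0ℓ)
open import Relation.Binary.Core using (Rel)
open import Relation.Binary.Definitions using (Decidable; Symmetric)
open import Relation.Binary.PropositionalEquality
  using (_≡_; _≢_; refl)
open import Relation.Nullary using (¬_)
open import Relation.Nullary.Decidable using (_⊎-dec_; _×-dec_)
open import Relation.Unary using (Pred)

IsLeast : Pred ℕ 0ℓ → Pred ℕ 0ℓ
IsLeast P m = P m × (∀ {j} → P j → m ≤ j)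

IsGreatest : Pred ℕ 0ℓ → Pred ℕ 0ℓ
IsGreatest P m = P m × (∀ {j} → P j → j ≤ m)

record SimpleGraph (n : ℕ) : Set₁ where
  field
    Adj    : Rel (Fin n) 0ℓ
    adj?   : Decidable Adj
    symm   : Symmetric Adj
    irrefl : ∀ {v} → ¬ Adj v v

open SimpleGraph public

record ProperColoring {n : ℕ} (G : SimpleGraph n) (k : ℕ) : Set where
  field
    color  : Fin n → Fin k
    proper : ∀ {u v} → Adj G u v → color u ≢ color v

open ProperColoring public

IsChromaticNumber : ∀ {n} → SimpleGraph n → ℕ → Set
IsChromaticNumber G = IsLeast (ProperColoring G)

-- In the next three definitions the palette size k is arbitrary; it is
-- fixed to the chromatic number in IsLowerLcs.

-- Colorings are compared pointwise, which avoids function extensionality.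
Determining : ∀ {n k} (G : SimpleGraph n) → ProperColoring G k → Subset n → Set
Determining {k = k} G c S =
  (c′ : ProperColoring G k) →
  (∀ v → v ∈ S → color c′ v ≡ color c v) →
  ∀ v → color c′ v ≡ color c v

Critical : ∀ {n k} (G : SimpleGraph n) → ProperColoring G k → Subset n → Set
Critical G c S = Determining G c S × (∀ T → T ⊂ S → ¬ Determining G c T)

-- IsLcs G c m: lcs(G,c) = m.
IsLcs : ∀ {n k} (G : SimpleGraph n) → ProperColoring G k → ℕ → Set
IsLcs G c = IsGreatest (λ m → ∃ λ X → Critical G c X × ∣ X ∣ ≡ m)

-- IsLowerLcs G m: m is the minimum of lcs(G,c) over the proper colorings c
-- of G with χ(G) colors.
IsLowerLcs : ∀ {n} → SimpleGraph n → ℕ → Set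
IsLowerLcs G m =
  ∃ λ k → IsChromaticNumber G k ×
          IsLeast (λ l → ∃ λ (c : ProperColoring G k) → IsLcs G c l) m

-- Next u v: v is the successor of u modulo n.
Next : ∀ {n} → Rel (Fin n) 0ℓ
Next {n} u v = suc (toℕ u) ≡ toℕ v ⊎ (suc (toℕ u) ≡ n × toℕ v ≡ 0)

next? : ∀ {n} → Decidable (Next {n})
next? {n} u v =
  (suc (toℕ u) ≟ toℕ v) ⊎-dec ((suc (toℕ u) ≟ n) ×-dec (toℕ v ≟ 0))

next-irrefl : ∀ {n} → 3 ≤ n → {v : Fin n} → ¬ Next v v
next-irrefl _ (inj₁ eq) = 1+n≢n eq
next-irrefl 3≤n {v} (inj₂ (eq , v≡0)) = absurd 3≤n eq v≡0
  where
  absurd : ∀ {n a} → 3 ≤ n → suc a ≡ n → a ≡ 0 → ⊥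
  absurd (s≤s ()) refl refl

cycle : (n : ℕ) → 3 ≤ n → SimpleGraph n
cycle n 3≤n = record
  { Adj    = λ u v → Next u v ⊎ Next v u
  ; adj?   = λ u v → next? u v ⊎-dec next? v u
  ; symm   = swap
  ; irrefl = λ { (inj₁ p) → next-irrefl 3≤n p ; (inj₂ p) → next-irrefl 3≤n p }
  }

{-# OPTIONS --safe #-}
-- On an odd cycle a set S is determining iff every vertex outside S has both
-- neighbours in S and these have different colors (call such a vertex rainbow);
-- critical sets are the complements of the maximal independent sets of rainbow
-- vertices.  Independence gives |S| ≥ (n + 1) / 2.  If equality holds then the
-- complement is an alternating set with a single gap.  When three consecutive
-- vertices are rainbow and the outer two lie in that complement, replacing them
-- by the middle one yields a critical set with one more element, unless this
-- happens at the gap.  For n ≡ 1 (mod 4) a parity argument along the cycle shows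
-- that such a replacement always exists, so (n + 1) / 2 is not the maximum.
-- The periodic pattern 0121, suitably cut off, attains the bounds.
module Submission where

open import Defs
open import Data.Bool using (Bool; true; false)
open import Data.Bool.Properties using (¬-not)
open import Data.Empty using (⊥; ⊥-elim)
open import Data.Fin using (Fin; toℕ; zero; suc; inject≤)
open import Data.Fin.Properties
  using (toℕ-injective; toℕ-fromℕ<; toℕ<n; all?; inject≤-injective)
  renaming (_≟_ to _≟ᶠ_)
open import Data.Fin.Subset using (Subset; _∈_; _⊂_; ∣_∣)
open import Data.List using (applyUpTo)
open import Data.Nat
  using (ℕ; zero; suc; _+_; _*_; _≤_; _<_; _/_; _%_; z≤n; s≤s; s≤s⁻¹; _<?_)
open import Data.Nat.DivMod
open import Data.Nat.ListAction using (sum)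
open import Data.Nat.Properties
open import Algebra.Properties.CommutativeSemigroup +-commutativeSemigroup using (interchange)
open import Data.Product using (∃; _×_; _,_; proj₁; proj₂)
open import Data.Sum using (_⊎_; inj₁; inj₂; [_,_]′)
open import Data.Vec using (lookup; _[_]≔_; []; _∷_; tabulate)
open import Data.Vec.Properties
  using ([]=⇒lookup; lookup⇒[]=; lookup∘update; lookup∘update′; lookup∘tabulate)
open import Function using (_∘_)
open import Relation.Binary.PropositionalEquality
open import Relation.Nullary using (¬_; yes; no; contradiction)
open import Relation.Nullary.Decidable using (from-yes; ¬?; _→-dec_; decidable-stable)

-- Three colors and local changes of a coloring.

-- Abstract, since unfolding the decision procedure is slow.
abstract
  third-color : ∀ (a b x y : Fin 3) → a ≢ b → x ≢ a → x ≢ b → y ≢ a → y ≢ b → x ≡ y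
  third-color = from-yes (all? λ (a : Fin 3) → all? λ b → all? λ x → all? λ y →
    ¬? (a ≟ᶠ b) →-dec ¬? (x ≟ᶠ a) →-dec ¬? (x ≟ᶠ b) →-dec
    ¬? (y ≟ᶠ a) →-dec ¬? (y ≟ᶠ b) →-dec (x ≟ᶠ y))

other-color : (a b : Fin 3) → ∃ λ x → x ≢ a × x ≢ b
other-color zero          zero          = suc zero , (λ ()) , λ ()
other-color zero          (suc zero)    = suc (suc zero) , (λ ()) , λ ()
other-color zero          (suc (suc _)) = suc zero , (λ ()) , λ { () }
other-color (suc zero)    zero          = suc (suc zero) , (λ ()) , λ ()
other-color (suc zero)    (suc _)       = zero , (λ ()) , λ ()
other-color (suc (suc _)) zero          = suc zero , (λ { () }) , λ ()
other-color (suc (suc _)) (suc _)       = zero , (λ ()) , λ ()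

recolor : ∀ {n k} (G : SimpleGraph n) (c : ProperColoring G k) v x →
  (∀ {w} → Adj G v w → x ≢ color c w) →
  ∃ λ (c′ : ProperColoring G k) →
    color c′ v ≡ x × (∀ w → w ≢ v → color c′ w ≡ color c w)
recolor {n} {k} G c v x ok = record { color = f ; proper = λ {u} {w} → f-proper u w } , at-v , off-v
  where
  f : Fin n → Fin k
  f w with w ≟ᶠ v
  ... | yes _ = x
  ... | no  _ = color c w
  at-v : f v ≡ x
  at-v with v ≟ᶠ v
  ... | yes _  = refl
  ... | no v≢v = contradiction refl v≢v
  off-v : ∀ w → w ≢ v → f w ≡ color c w
  off-v w w≢v with w ≟ᶠ v
  ... | yes w≡v = contradiction w≡v w≢v
  ... | no  _   = refl
  f-proper : ∀ u w → Adj G u w → f u ≢ f w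
  f-proper u w uw with u ≟ᶠ v | w ≟ᶠ v
  ... | yes refl | yes refl = contradiction uw (irrefl G)
  ... | yes refl | no _     = ok uw
  ... | no _     | yes refl = ok (symm G uw) ∘ sym
  ... | no _     | no _     = proper c uw

-- The edge is a whole Kempe component for its two colors: no other neighbour of one end carries the
-- color of the opposite end, so swapping them keeps the coloring proper.
exchange : ∀ {n k} (G : SimpleGraph n) (c : ProperColoring G k) {a b} → Adj G a b →
  (∀ {w} → w ≢ b → Adj G a w → color c b ≢ color c w) →
  (∀ {w} → w ≢ a → Adj G b w → color c a ≢ color c w) →
  ∃ λ (c′ : ProperColoring G k) →
    color c′ a ≡ color c b × (∀ w → w ≢ a → w ≢ b → color c′ w ≡ color c w)
exchange {n} {k} G c {a} {b} ab okᵃ okᵇ =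
  record { color = f ; proper = λ {u} {w} → f-proper u w } , at-a , off
  where
  f : Fin n → Fin k
  f w with w ≟ᶠ a | w ≟ᶠ b
  ... | yes _ | _     = color c b
  ... | no  _ | yes _ = color c a
  ... | no  _ | no _  = color c w
  at-a : f a ≡ color c b
  at-a with a ≟ᶠ a
  ... | yes _  = refl
  ... | no a≢a = contradiction refl a≢a
  off : ∀ w → w ≢ a → w ≢ b → f w ≡ color c w
  off w w≢a w≢b with w ≟ᶠ a | w ≟ᶠ b
  ... | yes w≡a | _       = contradiction w≡a w≢a
  ... | no  _   | yes w≡b = contradiction w≡b w≢b
  ... | no  _   | no _    = refl
  f-proper : ∀ u w → Adj G u w → f u ≢ f w
  f-proper u w uw with u ≟ᶠ a | u ≟ᶠ b | w ≟ᶠ a | w ≟ᶠ b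
  ... | yes refl | _        | yes refl | _        = contradiction uw (irrefl G)
  ... | yes refl | _        | no _     | yes refl = proper c ab ∘ sym
  ... | yes refl | _        | no _     | no w≢b   = okᵃ w≢b uw
  ... | no _     | yes refl | yes refl | _        = proper c ab
  ... | no _     | yes refl | no _     | yes refl = contradiction uw (irrefl G)
  ... | no _     | yes refl | no w≢a   | no _     = okᵇ w≢a uw
  ... | no _     | no u≢b   | yes refl | _        = okᵃ u≢b (symm G uw) ∘ sym
  ... | no u≢a   | no _     | no _     | yes refl = okᵇ u≢a (symm G uw) ∘ sym
  ... | no _     | no _     | no _     | no _     = proper c uw

-- Sizes of subsets and sums over initial segments.

∣insert∣ : ∀ {n} (S : Subset n) v → lookup S v ≡ false → ∣ S [ v ]≔ true ∣ ≡ suc ∣ S ∣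
∣insert∣ (false ∷ S) zero    _  = refl
∣insert∣ (true  ∷ S) (suc v) eq = cong suc (∣insert∣ S v eq)
∣insert∣ (false ∷ S) (suc v) eq = ∣insert∣ S v eq

∣delete∣ : ∀ {n} (S : Subset n) v → lookup S v ≡ true → suc ∣ S [ v ]≔ false ∣ ≡ ∣ S ∣
∣delete∣ (true  ∷ S) zero    _  = refl
∣delete∣ (true  ∷ S) (suc v) eq = cong suc (∣delete∣ S v eq)
∣delete∣ (false ∷ S) (suc v) eq = ∣delete∣ S v eq

∉∧∈⇒≢ : ∀ {n} {S : Subset n} {v w} → lookup S v ≡ false → w ∈ S → w ≢ v
∉∧∈⇒≢ v∉S w∈S refl with () ← trans (sym v∉S) ([]=⇒lookup w∈S)

∑ : (ℕ → ℕ) → ℕ → ℕ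
∑ f n = sum (applyUpTo f n)

∑-cong : ∀ {f g} → (∀ i → f i ≡ g i) → ∀ n → ∑ f n ≡ ∑ g n
∑-cong eq zero    = refl
∑-cong eq (suc n) = cong₂ _+_ (eq 0) (∑-cong (eq ∘ suc) n)

∑-last : ∀ f n → ∑ f (suc n) ≡ ∑ f n + f n
∑-last f zero    = +-identityʳ (f 0)
∑-last f (suc n) = trans (cong (f 0 +_) (∑-last (f ∘ suc) n)) (sym (+-assoc (f 0) _ _))

∑-+ : ∀ f g n → ∑ (λ i → f i + g i) n ≡ ∑ f n + ∑ g n
∑-+ f g zero    = refl
∑-+ f g (suc n) = trans (cong (f 0 + g 0 +_) (∑-+ (f ∘ suc) (g ∘ suc) n))
                        (interchange (f 0) (g 0) _ _)

-- A unit shift drops the first term and appends one that periodicity makes equal to it. Sums around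
-- the cycle may thus start anywhere, in particular at the gap.
∑-cyclic : ∀ f n → (∀ i → f (n + i) ≡ f i) → ∀ k → ∑ (λ i → f (i + k)) n ≡ ∑ f n
∑-cyclic f n per zero    = ∑-cong (λ i → cong f (+-identityʳ i)) n
∑-cyclic f n per (suc k) = trans (+-cancelˡ-≡ (f k) _ _ (begin
  f k + ∑ (λ i → f (i + suc k)) n  ≡⟨ cong (f k +_) (∑-cong (λ i → cong f (+-suc i k)) n) ⟩
  ∑ (λ i → f (i + k)) (suc n)      ≡⟨ ∑-last (λ i → f (i + k)) n ⟩
  ∑ (λ i → f (i + k)) n + f (n + k) ≡⟨ cong (∑ (λ i → f (i + k)) n +_) (per k) ⟩
  ∑ (λ i → f (i + k)) n + f k      ≡⟨ +-comm _ (f k) ⟩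
  f k + ∑ (λ i → f (i + k)) n      ∎)) (∑-cyclic f n per k)
  where open ≡-Reasoning

∑-≥ : ∀ f → (∀ i → 1 ≤ f i) → ∀ n → n ≤ ∑ f n
∑-≥ f f≥1 zero    = z≤n
∑-≥ f f≥1 (suc n) = +-mono-≤ (f≥1 0) (∑-≥ (f ∘ suc) (f≥1 ∘ suc) n)

-- Pigeonhole; with consecutive pairs as terms it locates the gap.
∑-excess : ∀ f n → n < ∑ f n → ∃ λ k → 1 < f k
∑-excess f (suc n) n<∑ with 1 <? f 0
... | yes 1<f = 0 , 1<f
... | no  1≮f with k , 1<f ← ∑-excess (f ∘ suc) n
  (+-cancelˡ-≤ 1 _ _ (≤-trans n<∑ (+-monoˡ-≤ _ (≮⇒≥ 1≮f)))) = suc k , 1<f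

∑-tight : ∀ f → (∀ i → 1 ≤ f i) → ∀ n → ∑ f n ≤ n → ∀ i → i < n → f i ≡ 1
∑-tight f f≥1 (suc n) ∑≤n zero _ = ≤-antisym
  (+-cancelʳ-≤ n _ _ (≤-trans (+-monoʳ-≤ (f 0) (∑-≥ (f ∘ suc) (f≥1 ∘ suc) n)) ∑≤n)) (f≥1 0)
∑-tight f f≥1 (suc n) ∑≤n (suc i) (s≤s i<n) = ∑-tight (f ∘ suc) (f≥1 ∘ suc) n
  (+-cancelˡ-≤ 1 _ _ (≤-trans (+-monoˡ-≤ _ (f≥1 0)) ∑≤n)) i i<n

bit : Bool → ℕ
bit false = 0
bit true  = 1

∣∣-∑ : ∀ {n} (S : Subset n) f → (∀ v → bit (lookup S v) ≡ f (toℕ v)) → ∣ S ∣ ≡ ∑ f n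
∣∣-∑ []          f eq = refl
∣∣-∑ (true  ∷ S) f eq = cong₂ _+_ (eq zero) (∣∣-∑ S (f ∘ suc) (eq ∘ suc))
∣∣-∑ (false ∷ S) f eq = cong₂ _+_ (eq zero) (∣∣-∑ S (f ∘ suc) (eq ∘ suc))

∑-pairs≡1 : ∀ f k → (∀ j → f (j * 2) + f (1 + j * 2) ≡ 1) → ∑ f (k * 2) ≡ k
∑-pairs≡1 f zero    eq = refl
∑-pairs≡1 f (suc k) eq =
  trans (sym (+-assoc (f 0) (f 1) _)) (cong₂ _+_ (eq 0) (∑-pairs≡1 (λ i → f (2 + i)) k (eq ∘ suc)))

∑-pairs≤1 : ∀ f k → (∀ j → j < k → f (j * 2) + f (1 + j * 2) ≤ 1) → ∑ f (k * 2) ≤ k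
∑-pairs≤1 f zero    le = z≤n
∑-pairs≤1 f (suc k) le = ≤-trans (≤-reflexive (sym (+-assoc (f 0) (f 1) _)))
  (+-mono-≤ (le 0 (s≤s z≤n)) (∑-pairs≤1 (λ i → f (2 + i)) k (λ j j<k → le (suc j) (s≤s j<k))))

bit≤1 : ∀ b → bit b ≤ 1
bit≤1 true  = ≤-refl
bit≤1 false = z≤n

-- Halving an odd lower bound rounds up: `n ≤ ∣ S ∣ + ∣ S ∣` becomes the bound (n + 1) / 2 on
-- `∣ S ∣`.
half : ∀ m a → suc (m * 2) ≤ a + a → suc m ≤ a
half m a le = ≰⇒> λ a≤m → n≮n (m * 2) (≤-trans le (≤-trans (+-mono-≤ a≤m a≤m)
  (≤-reflexive (trans (cong (m +_) (sym (+-identityʳ m))) (*-comm 2 m)))))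

head-bound : ∀ a b d {r k} → a + (b + d) ≤ 2 → r ≤ k → a + (b + (d + r)) ≤ 2 + k
head-bound a b d {r} le r≤k = ≤-trans
  (≤-reflexive (sym (trans (+-assoc a (b + d) r) (cong (a +_) (+-assoc b d r)))))
  (+-mono-≤ le r≤k)

two-colors : ∀ {a b c : Fin 2} → a ≢ b → b ≢ c → a ≡ c
two-colors {zero}     {zero}     a≢b _   = contradiction refl a≢b
two-colors {zero}     {suc zero} {zero}     _ _   = refl
two-colors {zero}     {suc zero} {suc zero} _ b≢c = contradiction refl b≢c
two-colors {suc zero} {zero}     {zero}     _ b≢c = contradiction refl b≢c
two-colors {suc zero} {zero}     {suc zero} _ _   = refl
two-colors {suc zero} {suc zero} a≢b _   = contradiction refl a≢b

-- The pattern 0121 and its alternating set.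

pat : ℕ → Fin 3
pat 0 = zero
pat 1 = suc zero
pat 2 = suc (suc zero)
pat 3 = suc zero
pat (suc (suc (suc (suc i)))) = pat i

alt : ℕ → Bool
alt 0 = true
alt 1 = false
alt (suc (suc i)) = alt i

pat-suc : ∀ i → pat i ≢ pat (1 + i)
pat-suc 0 ()
pat-suc 1 ()
pat-suc 2 ()
pat-suc 3 ()
pat-suc (suc (suc (suc (suc i)))) = pat-suc i

pat-odd : ∀ j → pat (1 + j * 2) ≡ suc zero
pat-odd 0 = refl
pat-odd 1 = refl
pat-odd (suc (suc j)) = pat-odd j

pat-even : ∀ j → pat (j * 2) ≢ pat (2 + j * 2)
pat-even 0 ()
pat-even 1 ()
pat-even (suc (suc j)) = pat-even j

-- Both constructions cut the pattern off at this position, so this color meets the closing edge of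
-- the cycle.
pat-2 : ∀ t → pat (2 + t * 2 * 2) ≡ suc (suc zero)
pat-2 zero    = refl
pat-2 (suc t) = pat-2 t

alt-even : ∀ j → alt (j * 2) ≡ true
alt-even zero    = refl
alt-even (suc j) = alt-even j

alt-odd : ∀ j → alt (1 + j * 2) ≡ false
alt-odd zero    = refl
alt-odd (suc j) = alt-odd j

-- Odd positions of `pat` all carry color 1 and even ones alternate between 0 and 2, so exactly the
-- odd positions see two different colors.
alt-forced : ∀ i → alt (1 + i) ≡ false → alt i ≡ true × alt (2 + i) ≡ true × pat i ≢ pat (2 + i)
alt-forced 0 _ = refl , refl , λ ()
alt-forced 2 _ = refl , refl , λ ()
alt-forced (suc (suc (suc (suc i)))) e = alt-forced i e

alt-tight : ∀ i → alt (1 + i) ≡ true → pat i ≡ pat (2 + i)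
alt-tight 1 _ = refl
alt-tight 3 _ = refl
alt-tight (suc (suc (suc (suc i)))) e = alt-tight i e

-- Positions on the cycle, read modulo `n`.

module Cycle (N : ℕ) (3≤n : 3 ≤ suc N) where

  n : ℕ
  n = suc N

  C : SimpleGraph n
  C = cycle n 3≤n

  -- Abstract, so that i is inferred from pos i.
  abstract
    pos : ℕ → Fin n
    pos i = i mod n

    toℕ-pos : ∀ i → toℕ (pos i) ≡ i % n
    toℕ-pos i = toℕ-fromℕ< (m%n<n i n)

  pos-cong : ∀ {i j} → i % n ≡ j % n → pos i ≡ pos j
  pos-cong {i} {j} eq = toℕ-injective (trans (toℕ-pos i) (trans eq (sym (toℕ-pos j))))

  pos-% : ∀ {i j} → pos i ≡ pos j → i % n ≡ j % n
  pos-% {i} {j} eq = trans (sym (toℕ-pos i)) (trans (cong toℕ eq) (toℕ-pos j))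

  pos-shift : ∀ k {i j} → pos i ≡ pos j → pos (k + i) ≡ pos (k + j)
  pos-shift k {i} {j} eq = pos-cong (begin
    (k + i) % n          ≡⟨ %-distribˡ-+ k i n ⟩
    (k % n + i % n) % n  ≡⟨ cong (λ r → (k % n + r) % n) (pos-% eq) ⟩
    (k % n + j % n) % n  ≡⟨ %-distribˡ-+ k j n ⟨
    (k + j) % n          ∎)
    where open ≡-Reasoning

  pos-toℕ : ∀ v → pos (toℕ v) ≡ v
  pos-toℕ v = toℕ-injective (trans (toℕ-pos (toℕ v)) (m<n⇒m%n≡m (toℕ<n v)))

  pos-periodic : ∀ i → pos (n + i) ≡ pos i
  pos-periodic i = pos-cong (trans (cong (_% n) (+-comm n i)) ([m+n]%n≡m%n i n))

  -- Shifting by `N` undoes a successor modulo `n`, which stands in for subtraction.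
  pos-suc-injective : ∀ {i j} → pos (suc i) ≡ pos (suc j) → pos i ≡ pos j
  pos-suc-injective {i} {j} eq =
    trans (sym (pos-N+suc i)) (trans (pos-shift N eq) (pos-N+suc j))
    where
    pos-N+suc : ∀ k → pos (N + suc k) ≡ pos k
    pos-N+suc k = trans (cong pos (+-suc N k)) (pos-periodic k)

  -- Adding `i * N` to both sides turns `i` into a multiple of `n`, so an equality would make
  -- `suc d` vanish modulo `n`.
  pos-distinct : ∀ d i → suc d < n → pos i ≢ pos (suc d + i)
  pos-distinct d i d<n eq = 0≢1+n (begin
    0                        ≡⟨ m*n%n≡0 i n ⟨
    (i * n) % n              ≡⟨ cong (_% n) (lem 0) ⟨
    (i * N + i) % n          ≡⟨ pos-% (pos-shift (i * N) eq) ⟩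
    (i * N + (suc d + i)) % n ≡⟨ cong (_% n) (lem (suc d)) ⟩
    (suc d + i * n) % n      ≡⟨ [m+kn]%n≡m%n (suc d) i n ⟩
    suc d % n                ≡⟨ m<n⇒m%n≡m d<n ⟩
    suc d                    ∎)
    where
    open ≡-Reasoning
    lem : ∀ k → i * N + (k + i) ≡ k + i * n
    lem k = trans (+-comm (i * N) (k + i)) (trans (+-assoc k i (i * N))
              (cong (k +_) (sym (*-suc i N))))

  -- The successor form makes any vertex the middle of a triple `i`, `1 + i`, `2 + i`, the shape of
  -- all the local conditions.
  pos-cover : ∀ v → ∃ λ i → v ≡ pos (suc i)
  pos-cover v = N + toℕ v , sym (trans (pos-periodic (toℕ v)) (pos-toℕ v))

  Next-pos : ∀ {u v : Fin n} → Next u v → v ≡ pos (suc (toℕ u))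
  Next-pos {u} {v} (inj₁ eq) =
    trans (sym (pos-toℕ v)) (cong pos (sym eq))
  Next-pos {u} {v} (inj₂ (eq , v≡0)) =
    trans (sym (pos-toℕ v)) (trans (cong pos v≡0)
      (trans (sym (pos-periodic 0)) (cong pos (trans (+-identityʳ n) (sym eq)))))

  pos-Next : ∀ i → Next (pos i) (pos (suc i))
  pos-Next i with suc (toℕ (pos i)) <? n
  ... | yes r<n = inj₁ (sym (begin
    toℕ (pos (suc i))               ≡⟨ cong toℕ (pos-shift 1 (pos-toℕ (pos i))) ⟨
    toℕ (pos (suc (toℕ (pos i))))   ≡⟨ toℕ-pos _ ⟩
    suc (toℕ (pos i)) % n           ≡⟨ m<n⇒m%n≡m r<n ⟩
    suc (toℕ (pos i))               ∎))
    where open ≡-Reasoning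
  ... | no r≮n = inj₂ (r≡n , (begin
    toℕ (pos (suc i))               ≡⟨ cong toℕ (pos-shift 1 (pos-toℕ (pos i))) ⟨
    toℕ (pos (suc (toℕ (pos i))))   ≡⟨ cong (toℕ ∘ pos) r≡n ⟩
    toℕ (pos n)                     ≡⟨ toℕ-pos n ⟩
    n % n                           ≡⟨ n%n≡0 n ⟩
    0                               ∎))
    where
    open ≡-Reasoning
    r≡n : suc (toℕ (pos i)) ≡ n
    r≡n = ≤-antisym (toℕ<n (pos i)) (≮⇒≥ r≮n)

  pos-Adj : ∀ i → Adj C (pos i) (pos (suc i))
  pos-Adj i = inj₁ (pos-Next i)

  neighbours : ∀ {i w} → Adj C (pos (suc i)) w → w ≡ pos i ⊎ w ≡ pos (2 + i)
  neighbours {i} (inj₁ nx) = inj₂ (trans (Next-pos nx) (pos-shift 1 (pos-toℕ (pos (suc i)))))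
  neighbours {i} {w} (inj₂ nx) =
    inj₁ (trans (sym (pos-toℕ w)) (pos-suc-injective (sym (Next-pos nx))))

  -- Critical sets in local terms.

  -- Local forms of "S is determining" and "no vertex of S can be dropped".
  Forced : (Fin n → Fin 3) → Subset n → Set
  Forced c S = ∀ i → lookup S (pos (1 + i)) ≡ false →
    lookup S (pos i) ≡ true × lookup S (pos (2 + i)) ≡ true × c (pos i) ≢ c (pos (2 + i))

  Tight : (Fin n → Fin 3) → Subset n → Set
  Tight c S = ∀ i → lookup S (pos (1 + i)) ≡ true → c (pos i) ≢ c (pos (2 + i)) →
    lookup S (pos i) ≡ false ⊎ lookup S (pos (2 + i)) ≡ false

  module _ (c : ProperColoring C 3) where

    private
      κ : ℕ → Fin 3
      κ i = color c (pos i)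

    color-suc : ∀ i → κ i ≢ κ (suc i)
    color-suc i = proper c (pos-Adj i)

    -- If the neighbours shared a color, this vertex alone could take a color different from theirs
    -- and from its own, a change invisible on `S`.
    determining⇒rainbow : ∀ {S} → Determining C c S →
      ∀ i → lookup S (pos (1 + i)) ≡ false → κ i ≢ κ (2 + i)
    determining⇒rainbow {S} det i v∉S eq
      with x , x≢l , x≢v ← other-color (κ i) (κ (suc i))
      with c′ , at , off ← recolor C c (pos (suc i)) x
             (λ a → [ (λ { refl → x≢l }) , (λ { refl → x≢l ∘ λ e → trans e (sym eq) }) ]′ (neighbours {i} a))
      = x≢v (trans (sym at) (det c′ (λ w w∈S → off w (∉∧∈⇒≢ {S = S} v∉S w∈S)) _))

    -- If 1 + i and 2 + i are both rainbow then i and 3 + i have the same color,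
    -- so exchanging the colors of 1 + i and 2 + i is proper.
    determining⇒covered : ∀ {S} → Determining C c S →
      ∀ i → lookup S (pos (1 + i)) ≡ false → lookup S (pos (2 + i)) ≡ true
    determining⇒covered {S} det i v∉S with lookup S (pos (2 + i)) in w∉S
    ... | true  = refl
    ... | false
      with c′ , at , off ← exchange C c {pos (1 + i)} {pos (2 + i)} (pos-Adj (suc i))
             (λ w≢b a → [ (λ { refl → determining⇒rainbow {S} det i v∉S ∘ sym })
                        , (λ e → contradiction e w≢b) ]′ (neighbours {i} a))
             (λ w≢a a → [ (λ e → contradiction e w≢a)
                        , (λ { refl → determining⇒rainbow {S} det (suc i) w∉S }) ]′ (neighbours {suc i} a))
      = contradiction
          (trans (sym at) (det c′ (λ w w∈S → off w (∉∧∈⇒≢ {S = S} v∉S w∈S) (∉∧∈⇒≢ {S = S} w∉S w∈S)) _))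
          (color-suc (suc i) ∘ sym)

    determining⇒forced : ∀ {S} → Determining C c S → Forced (color c) S
    determining⇒forced {S} det i v∉S =
      left , determining⇒covered {S} det i v∉S , determining⇒rainbow {S} det i v∉S
      where
      -- `N + i` acts as the predecessor of `i`: were `i` outside `S`, `determining⇒covered` there
      -- would put `1 + i` into `S`.
      i′ : ℕ
      i′ = N + i
      left : lookup S (pos i) ≡ true
      left with lookup S (pos i) in eq
      ... | true  = refl
      ... | false with () ← trans (sym v∉S) (trans (cong (lookup S) (sym (pos-shift 1 (pos-periodic i))))
                    (determining⇒covered {S} det i′ (trans (cong (lookup S) (pos-periodic i)) eq)))

    -- Both neighbours of a missing vertex are fixed with different colors, which leaves only the
    -- third color for it.
    forced⇒determining : ∀ {S} → Forced (color c) S → Determining C c S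
    forced⇒determining {S} forced c′ agree v with lookup S v in eq
    ... | true  = agree v (lookup⇒[]= v S eq)
    ... | false with i , refl ← pos-cover v with l , r , rb ← forced i eq =
      third-color (κ i) (κ (2 + i)) _ _ rb
        (λ e → proper c′ (pos-Adj i) (sym (trans e (sym (at l)))))
        (λ e → proper c′ (pos-Adj (suc i)) (trans e (sym (at r))))
        (color-suc i ∘ sym) (color-suc (suc i))
      where
      at : ∀ {w} → lookup S w ≡ true → color c′ w ≡ color c w
      at {w} e = agree w (lookup⇒[]= w S e)

    -- A rainbow vertex of `S` with both neighbours in `S` could be deleted, against minimality.
    critical⇒tight : ∀ {S} → Critical C c S → Tight (color c) S
    critical⇒tight {S} (det , minimal) i v∈S rb
      with lookup S (pos i) in l | lookup S (pos (2 + i)) in r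
    ... | false | _     = inj₁ refl
    ... | true  | false = inj₂ refl
    ... | true  | true  = ⊥-elim (minimal T T⊂S (forced⇒determining {T} T-forced))
      where
      v : Fin n
      v = pos (suc i)
      T : Subset n
      T = S [ v ]≔ false
      v∉T : lookup T v ≡ false
      v∉T = lookup∘update v S false
      off : ∀ {w} → w ≢ v → lookup T w ≡ lookup S w
      off w≢v = lookup∘update′ w≢v S false
      T⊂S : T ⊂ S
      T⊂S = (λ {w} w∈T → lookup⇒[]= w S (trans (sym (off (∉∧∈⇒≢ {S = T} v∉T w∈T))) ([]=⇒lookup w∈T)))
          , v , lookup⇒[]= v S v∈S , λ v∈T → ∉∧∈⇒≢ {S = T} v∉T v∈T refl
      adj≢ : ∀ j → pos j ≢ pos (suc j)
      adj≢ j = pos-distinct 0 j (≤-trans (s≤s (s≤s z≤n)) 3≤n)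
      T-forced : Forced (color c) T
      T-forced j w∉T with pos (suc j) ≟ᶠ v
      ... | yes w≡v = trans (off (λ e → adj≢ i (trans (sym e₀) e))) (trans (cong (lookup S) e₀) l)
                    , trans (off (λ e → adj≢ (suc i) (sym (trans (sym e₂) e)))) (trans (cong (lookup S) e₂) r)
                    , λ e → rb (trans (cong (color c) (sym e₀)) (trans e (cong (color c) e₂)))
        where
        e₀ : pos j ≡ pos i
        e₀ = pos-suc-injective w≡v
        e₂ : pos (2 + j) ≡ pos (2 + i)
        e₂ = pos-shift 1 w≡v
      -- Both neighbours of `v` lie in `S`, so a vertex outside `S` is not adjacent to `v` and keeps
      -- its neighbours in `T`.
      ... | no w≢v with l′ , r′ , rb′ ← determining⇒forced {S} det j (trans (sym (off w≢v)) w∉T) =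
          keep (λ e → false≢true (trans (sym w∉S) (trans (cong (lookup S) (pos-shift 1 e)) r))) l′
        , keep (λ e → false≢true (trans (sym w∉S) (trans (cong (lookup S) (pos-suc-injective e)) l))) r′
        , rb′
        where
        false≢true : false ≢ true
        false≢true ()
        w∉S : lookup S (pos (suc j)) ≡ false
        w∉S = trans (sym (off w≢v)) w∉T
        keep : ∀ {w} → w ≢ v → lookup S w ≡ true → lookup T w ≡ true
        keep w≢v e = trans (off w≢v) e

    -- A vertex dropped by a smaller determining set is rainbow with both neighbours in that set,
    -- hence in `S`, against tightness.
    forced∧tight⇒critical : ∀ {S} → Forced (color c) S → Tight (color c) S → Critical C c S
    forced∧tight⇒critical {S} forced tight = forced⇒determining {S} forced , minimal
      where
      minimal : ∀ T → T ⊂ S → ¬ Determining C c T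
      minimal T (T⊆S , v , v∈S , v∉T) det with i , refl ← pos-cover v
        with l , r , rb ← determining⇒forced {T} det i (¬-not (v∉T ∘ lookup⇒[]= _ T))
        with tight i ([]=⇒lookup v∈S) rb
      ... | inj₁ e = ∉∧∈⇒≢ {S = S} e (T⊆S (lookup⇒[]= _ T l)) refl
      ... | inj₂ e = ∉∧∈⇒≢ {S = S} e (T⊆S (lookup⇒[]= _ T r)) refl

  -- Double counting over consecutive pairs.

  ∣∣-pos : (S : Subset n) → ∣ S ∣ ≡ ∑ (λ i → bit (lookup S (pos i))) n
  ∣∣-pos S = ∣∣-∑ S (λ i → bit (lookup S (pos i))) (λ v → cong (bit ∘ lookup S) (sym (pos-toℕ v)))

  pairs : Subset n → ℕ → ℕ
  pairs S i = bit (lookup S (pos i)) + bit (lookup S (pos (suc i)))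

  ∑-pairs : ∀ S → ∑ (pairs S) n ≡ ∣ S ∣ + ∣ S ∣
  ∑-pairs S = begin
    ∑ (pairs S) n               ≡⟨ ∑-+ f (f ∘ suc) n ⟩
    ∑ f n + ∑ (f ∘ suc) n       ≡⟨ cong (∑ f n +_) (∑-cong (λ i → cong f (+-comm 1 i)) n) ⟩
    ∑ f n + ∑ (λ i → f (i + 1)) n ≡⟨ cong (∑ f n +_) (∑-cyclic f n (cong (bit ∘ lookup S) ∘ pos-periodic) 1) ⟩
    ∑ f n + ∑ f n               ≡⟨ cong₂ _+_ (∣∣-pos S) (∣∣-pos S) ⟨
    ∣ S ∣ + ∣ S ∣               ∎
    where
    open ≡-Reasoning
    f : ℕ → ℕ
    f i = bit (lookup S (pos i))

  pairs-≥1 : ∀ {c S} → Forced c S → ∀ i → 1 ≤ pairs S i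
  pairs-≥1 {S = S} forced i with lookup S (pos (suc i)) in eq
  ... | true  = m≤n+m 1 _
  ... | false rewrite proj₁ (forced i eq) = ≤-refl

  forced⇒n≤2∣S∣ : ∀ {c S} → Forced c S → n ≤ ∣ S ∣ + ∣ S ∣
  forced⇒n≤2∣S∣ {c} {S} forced = subst (n ≤_) (∑-pairs S) (∑-≥ _ (pairs-≥1 {c} {S} forced) n)

  -- Enlarging a critical set.

  -- The complement of S trades 2 + i and 4 + i for 3 + i.  The last two hypotheses
  -- ensure that 1 + i and 5 + i cannot be dropped from the new set.
  augment : 5 ≤ n → (c : ProperColoring C 3) → let κ = color c ∘ pos in
    ∀ S → Critical C c S → ∀ i →
    lookup S (pos (2 + i)) ≡ false → lookup S (pos (4 + i)) ≡ false → κ (2 + i) ≢ κ (4 + i) →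
    lookup S (pos i) ≡ false ⊎ κ i ≡ κ (2 + i) →
    lookup S (pos (6 + i)) ≡ false ⊎ κ (4 + i) ≡ κ (6 + i) →
    ∃ λ T → Critical C c T × ∣ T ∣ ≡ suc ∣ S ∣
  augment 5≤n c S crit i x∉S z∉S rb left right =
    T , forced∧tight⇒critical c {T} T-forced T-tight , ∣T∣
    where
    κ : ℕ → Fin 3
    κ = color c ∘ pos
    forced : Forced (color c) S
    forced = determining⇒forced c {S} (proj₁ crit)
    x y z : Fin n
    x = pos (2 + i)
    y = pos (3 + i)
    z = pos (4 + i)
    T₁ T₂ T : Subset n
    T₁ = S [ x ]≔ true
    T₂ = T₁ [ z ]≔ true
    T  = T₂ [ y ]≔ false
    adj≢ : ∀ j → pos j ≢ pos (1 + j)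
    adj≢ j = pos-distinct 0 j (≤-trans (s≤s (s≤s z≤n)) 5≤n)
    adj₂≢ : ∀ j → pos j ≢ pos (2 + j)
    adj₂≢ j = pos-distinct 1 j (≤-trans (s≤s (s≤s (s≤s z≤n))) 5≤n)
    -- `5 ≤ n` is what separates `6 + i` from `2 + i`, and `i` from `4 + i`, around the cycle.
    adj₄≢ : ∀ j → pos j ≢ pos (4 + j)
    adj₄≢ j = pos-distinct 3 j 5≤n
    Tx : lookup T x ≡ true
    Tx = trans (lookup∘update′ (adj≢ (2 + i)) T₂ false)
        (trans (lookup∘update′ (adj₂≢ (2 + i)) T₁ true) (lookup∘update x S true))
    Ty : lookup T y ≡ false
    Ty = lookup∘update y T₂ false
    Tz : lookup T z ≡ true
    Tz = trans (lookup∘update′ (adj≢ (3 + i) ∘ sym) T₂ false) (lookup∘update z T₁ true)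
    T-off : ∀ {w} → w ≢ x → w ≢ y → w ≢ z → lookup T w ≡ lookup S w
    T-off w≢x w≢y w≢z = trans (lookup∘update′ w≢y T₂ false)
      (trans (lookup∘update′ w≢z T₁ true) (lookup∘update′ w≢x S true))
    ∣T∣ : ∣ T ∣ ≡ suc ∣ S ∣
    ∣T∣ = suc-injective (begin
      suc ∣ T ∣       ≡⟨ ∣delete∣ T₂ y T₂y ⟩
      ∣ T₂ ∣          ≡⟨ ∣insert∣ T₁ z (trans (lookup∘update′ (adj₂≢ (2 + i) ∘ sym) S true) z∉S) ⟩
      suc ∣ T₁ ∣      ≡⟨ cong suc (∣insert∣ S x x∉S) ⟩
      suc (suc ∣ S ∣) ∎)
      where
      open ≡-Reasoning
      T₂y : lookup T₂ y ≡ true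
      T₂y = trans (lookup∘update′ (adj≢ (3 + i)) T₁ true)
           (trans (lookup∘update′ (adj≢ (2 + i) ∘ sym) S true) (proj₁ (proj₂ (forced (1 + i) x∉S))))
    keep : ∀ {w} → w ≢ y → lookup S w ≡ true → lookup T w ≡ true
    keep {w} w≢y w∈S with w ≟ᶠ x | w ≟ᶠ z
    ... | yes refl | _        = Tx
    ... | no _     | yes refl = Tz
    ... | no w≢x   | no w≢z   = trans (T-off w≢x w≢y w≢z) w∈S
    gone : ∀ {w} → w ≢ x → w ≢ z → lookup S w ≡ false → lookup T w ≡ false
    gone {w} w≢x w≢z w∉S with w ≟ᶠ y
    ... | yes refl = Ty
    ... | no w≢y   = trans (T-off w≢x w≢y w≢z) w∉S
    clash : ∀ {w} → lookup T w ≡ true → lookup T w ≢ false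
    clash e e′ with () ← trans (sym e) e′
    apart : ∀ {u w} → lookup T w ≡ true → lookup T u ≡ false → u ≢ w
    apart e e′ refl = clash e e′

    T-forced : Forced (color c) T
    T-forced j v∉T with pos (suc j) ≟ᶠ y
    ... | yes v≡y =
        trans (cong (lookup T) e₀) Tx , trans (cong (lookup T) e₂) Tz
      , λ e → rb (trans (cong (color c) (sym e₀)) (trans e (cong (color c) e₂)))
      where
      e₀ : pos j ≡ x
      e₀ = pos-suc-injective v≡y
      e₂ : pos (2 + j) ≡ z
      e₂ = pos-shift 1 v≡y
    ... | no v≢y with l , r , rb′ ← forced j (trans (sym (T-off (apart Tx v∉T) v≢y (apart Tz v∉T))) v∉T) =
        keep (apart Tz v∉T ∘ pos-shift 1) l , keep (apart Tx v∉T ∘ pos-suc-injective) r , rb′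

    T-tight : Tight (color c) T
    T-tight j v∈T rb′ with pos (suc j) ≟ᶠ x | pos (suc j) ≟ᶠ y | pos (suc j) ≟ᶠ z
    ... | yes v≡x | _       | _       = inj₂ (trans (cong (lookup T) (pos-shift 1 v≡x)) Ty)
    ... | no _    | yes v≡y | _       = contradiction (trans (cong (lookup T) v≡y) Ty) (clash v∈T)
    ... | no _    | no _    | yes v≡z = inj₁ (trans (cong (lookup T) (pos-suc-injective v≡z)) Ty)
    ... | no v≢x  | no v≢y  | no v≢z
      with critical⇒tight c {S} crit j (trans (sym (T-off v≢x v≢y v≢z)) v∈T) rb′
    ... | inj₁ l∉S with pos j ≟ᶠ z
    ...   | no l≢z = inj₁ (gone (v≢y ∘ pos-shift 1) l≢z l∉S)
    -- The vertex is `5 + i`, and the missing neighbour `z` that made it tight is now in `T`. By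
    -- `right`, either `6 + i` is missing instead or the vertex is not rainbow. The case of `1 + i`
    -- below is symmetric.
    ...   | yes l≡z = [ (λ e → inj₂ (trans (cong (lookup T) e₂)
                             (gone (adj₄≢ (2 + i) ∘ sym) (adj₂≢ (4 + i) ∘ sym) e)))
                      , (λ e → contradiction (trans (cong (color c) l≡z) (trans e (cong (color c) (sym e₂)))) rb′) ]′ right
      where
      e₂ : pos (2 + j) ≡ pos (6 + i)
      e₂ = pos-shift 2 l≡z
    T-tight j v∈T rb′ | no v≢x | no v≢y | no v≢z | inj₂ r∉S with pos (2 + j) ≟ᶠ x
    ...   | no r≢x = inj₂ (gone r≢x (v≢y ∘ pos-suc-injective) r∉S)
    ...   | yes r≡x = [ (λ e → inj₁ (trans (cong (lookup T) e₀) (gone (adj₂≢ i) (adj₄≢ i) e)))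
                      , (λ e → contradiction (trans (cong (color c) e₀) (trans e (cong (color c) (sym r≡x)))) rb′) ]′ left
      where
      e₀ : pos j ≡ pos i
      e₀ = pos-suc-injective (pos-suc-injective r≡x)

-- Excluding the maximum (n + 1) / 2 when n ≡ 1 (mod 4).

module OneModFour (t′ : ℕ) (3≤n : 3 ≤ suc (suc t′ * 2 * 2)) where
  open Cycle (suc t′ * 2 * 2) 3≤n

  -- Half of `n` minus one, and itself even; `suc m` is the size to be excluded as a maximum.
  m : ℕ
  m = suc t′ * 2

  module _ (c : ProperColoring C 3) (S : Subset n) (crit : Critical C c S) (∣S∣ : ∣ S ∣ ≡ suc m)
           (max : ∀ T → Critical C c T → ∣ T ∣ ≤ suc m) where

    private
      forced : Forced (color c) S
      forced = determining⇒forced c {S} (proj₁ crit)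

      -- Every pair contributes at least 1, so a total of `suc n` means that exactly one pair, the
      -- gap, contributes 2.
      ∑≡ : ∑ (pairs S) n ≡ suc n
      ∑≡ = trans (∑-pairs S) (trans (cong₂ _+_ ∣S∣ ∣S∣) (cong suc (trans (+-suc m m)
             (cong suc (trans (cong (m +_) (sym (+-identityʳ m))) (*-comm 2 m))))))

      -- Read from position k, the members of S are 0 and the odd positions.
      module Gap (k : ℕ) (gap : 1 < pairs S k) where

        both : ∀ b b′ → 1 < bit b + bit b′ → b ≡ true × b′ ≡ true
        both true true _ = refl , refl
        both true false (s≤s ())
        both false true (s≤s ())

        s : ℕ → Bool
        s i = lookup S (pos (i + k))
        s0 : s 0 ≡ true
        s0 = proj₁ (both (s 0) (s 1) gap)
        s1 : s 1 ≡ true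
        s1 = proj₂ (both (s 0) (s 1) gap)

        -- The gap uses up the whole surplus: the other `m * 2` pairs have total `m * 2`, so each
        -- contributes exactly 1.
        one-each : ∀ i → i < m * 2 → bit (s (1 + i)) + bit (s (2 + i)) ≡ 1
        one-each = ∑-tight _ (λ i → pairs-≥1 {color c} {S} forced (suc i + k)) (m * 2)
          (≤-reflexive (+-cancelˡ-≡ 2 _ _ (begin
            2 + ∑ (λ i → pairs S (suc i + k)) (m * 2)
              ≡⟨ cong (_+ ∑ (λ i → pairs S (suc i + k)) (m * 2)) (cong₂ _+_ (cong bit s0) (cong bit s1)) ⟨
            ∑ (λ i → pairs S (i + k)) n
              ≡⟨ ∑-cyclic (pairs S) n pairs-periodic k ⟩
            ∑ (pairs S) n
              ≡⟨ ∑≡ ⟩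
            suc n ∎)))
          where
          open ≡-Reasoning
          pairs-periodic : ∀ i → pairs S (n + i) ≡ pairs S i
          pairs-periodic i = cong₂ (λ u v → bit (lookup S u) + bit (lookup S v))
            (pos-periodic i) (pos-shift 1 (pos-periodic i))

        flip-true : ∀ b b′ → b ≡ true → bit b + bit b′ ≡ 1 → b′ ≡ false
        flip-true true false _ _ = refl
        flip-false : ∀ b b′ → b ≡ false → bit b + bit b′ ≡ 1 → b′ ≡ true
        flip-false false true _ _ = refl

        bound : ∀ {j} → j < m → 2 + j * 2 ≤ m * 2
        bound j<m = *-monoˡ-≤ 2 j<m

        inside : ∀ j → j ≤ m → s (1 + j * 2) ≡ true
        outside : ∀ j → j < m → s (2 + j * 2) ≡ false
        inside zero    _   = s1
        inside (suc j) j<m = flip-false _ _ (outside j j<m) (one-each (1 + j * 2) (bound j<m))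
        outside j j<m = flip-true _ _ (inside j (<⇒≤ j<m)) (one-each (j * 2) (<⇒≤ (bound j<m)))

        D : ℕ → Fin 3
        D i = color c (pos (i + k))

        D≢ : ∀ i → D i ≢ D (1 + i)
        D≢ i = color-suc c (i + k)

        D-periodic : ∀ i → D (n + i) ≡ D i
        D-periodic i = cong (color c) (trans (cong pos (+-assoc n i k)) (pos-periodic (i + k)))

        rainbow : ∀ j → j < m → D (1 + j * 2) ≢ D (3 + j * 2)
        rainbow j j<m = proj₂ (proj₂ (forced (1 + j * 2 + k) (outside j j<m)))

        5≤n : 5 ≤ n
        5≤n = s≤s (s≤s (s≤s (s≤s (s≤s z≤n))))

        -- Otherwise `augment` would give a critical set larger than `max` allows.
        plain : ∀ j → suc j < m → s (j * 2) ≡ false ⊎ D (j * 2) ≡ D (2 + j * 2) →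
          s (6 + j * 2) ≡ false ⊎ D (4 + j * 2) ≡ D (6 + j * 2) →
          D (2 + j * 2) ≡ D (4 + j * 2)
        plain j j<m left right = decidable-stable (D (2 + j * 2) ≟ᶠ D (4 + j * 2)) λ rb →
          too-big (augment 5≤n c S crit (j * 2 + k)
            (outside j (<⇒≤ j<m)) (outside (suc j) j<m) rb left right)
          where
          too-big : ¬ ∃ λ T → Critical C c T × ∣ T ∣ ≡ suc ∣ S ∣
          too-big (T , critᵀ , ∣T∣) = n≮n (suc m) (subst (_≤ suc m) (trans ∣T∣ (cong suc ∣S∣)) (max T critᵀ))

        -- Away from the gap `plain` applies unconditionally, so `4 + j * 2` and `6 + j * 2` share a
        -- color. Both positions in question then avoid that color and the color of `5 + j * 2`.
        inner : ∀ j → 3 + j < m → D (3 + j * 2) ≡ D (7 + j * 2)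
        inner j j<m = third-color (D (4 + j * 2)) (D (5 + j * 2)) _ _ (D≢ (4 + j * 2))
          (D≢ (3 + j * 2)) (rainbow (1 + j) (<⇒≤ (<⇒≤ j<m)))
          (λ e → D≢ (6 + j * 2) (trans (sym D4≡D6) (sym e)))
          (rainbow (2 + j) (<⇒≤ j<m) ∘ sym)
          where
          D4≡D6 : D (4 + j * 2) ≡ D (6 + j * 2)
          D4≡D6 = plain (1 + j) (<⇒≤ j<m) (inj₁ (outside j (<⇒≤ (<⇒≤ (<⇒≤ j<m))))) (inj₁ (outside (3 + j) j<m))

        -- This is where n ≡ 1 (mod 4) enters: steps of 4 from position 3 end exactly at `3 + X`,
        -- two before the return to 0.
        odds : ∀ r → r < suc t′ → D (3 + r * 2 * 2) ≡ D 3
        odds zero    _   = refl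
        odds (suc r) r<t = trans (sym (inner (r * 2) (*-monoˡ-≤ 2 r<t))) (odds r (<⇒≤ r<t))

        X : ℕ
        X = t′ * 2 * 2
        D3+X≡D3 : D (3 + X) ≡ D 3
        D3+X≡D3 = odds t′ ≤-refl
        D5+X≡D0 : D (5 + X) ≡ D 0
        D5+X≡D0 = trans (cong D (sym (+-identityʳ (5 + X)))) (D-periodic 0)
        D6+X≡D1 : D (6 + X) ≡ D 1
        D6+X≡D1 = trans (cong D (sym (+-comm (5 + X) 1))) (D-periodic 1)
        D1≢D3 : D 1 ≢ D 3
        D1≢D3 = rainbow 0 (s≤s z≤n)
        D0≢D3 : D 0 ≢ D 3
        D0≢D3 e = rainbow (1 + t′ * 2) ≤-refl (trans D3+X≡D3 (trans (sym e) (sym D5+X≡D0)))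
        -- This and `D4+X≡D1` say that the gap vertices 1 and 0 are not rainbow. Both lie in `S`, so
        -- at the two ends `plain` needs its color alternatives.
        D0≡D2 : D 0 ≡ D 2
        D0≡D2 = third-color (D 1) (D 3) _ _ D1≢D3 (D≢ 0) D0≢D3 (D≢ 1 ∘ sym) (D≢ 2)
        D4+X≡D1 : D (4 + X) ≡ D 1
        D4+X≡D1 = third-color (D 0) (D 3) _ _ D0≢D3
          (λ e → D≢ (4 + X) (trans e (sym D5+X≡D0)))
          (λ e → D≢ (3 + X) (trans D3+X≡D3 (sym e)))
          (D≢ 0 ∘ sym) D1≢D3

        -- `plain` now holds all the way round: non-membership supplies its side conditions inside,
        -- and the colors at the gap supply them at the first and last step.
        evens : ∀ j → j < m → D (2 + j * 2) ≡ D 2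
        evens zero    _   = refl
        evens (suc j) j<m = trans (sym (plain j j<m (left j j<m) right)) (evens j (<⇒≤ j<m))
          where
          left : ∀ j → suc j < m → s (j * 2) ≡ false ⊎ D (j * 2) ≡ D (2 + j * 2)
          left zero    _   = inj₂ D0≡D2
          left (suc j) j<m = inj₁ (outside j (<⇒≤ (<⇒≤ j<m)))
          right : s (6 + j * 2) ≡ false ⊎ D (4 + j * 2) ≡ D (6 + j * 2)
          right with m≤n⇒m<n∨m≡n j<m
          ... | inj₁ 2+j<m = inj₁ (outside (2 + j) 2+j<m)
          ... | inj₂ refl  = inj₂ (trans D4+X≡D1 (sym D6+X≡D1))

        -- The last even position `4 + X` would have the color of 2, hence of 0, but it has the
        -- color of 1.
        absurd : ⊥
        absurd = D≢ 0 (trans D0≡D2 (trans (sym (evens (1 + t′ * 2) ≤-refl)) D4+X≡D1))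

    critical-suc-m-not-largest : ⊥
    critical-suc-m-not-largest with k , gap ← ∑-excess (pairs S) n (≤-reflexive (sym ∑≡)) = Gap.absurd k gap

-- Colorings and sets given by finite sequences.

module ExplicitCycle (K : ℕ) (3≤n : 3 ≤ 2 + K) where
  open Cycle (suc K) 3≤n public

  toℕ-pos-< : ∀ {i} → i < n → toℕ (pos i) ≡ i
  toℕ-pos-< {i} i<n = trans (toℕ-pos i) (m<n⇒m%n≡m i<n)

  pos-n : ∀ i → pos (i + n) ≡ pos i
  pos-n i = trans (cong pos (+-comm i n)) (pos-periodic i)

  -- Only two triples of consecutive vertices cross the end of the sequence; they become separate
  -- goals, and elsewhere indices need no reduction.
  cyclic-triples : (P : ℕ → ℕ → ℕ → Set) →
    (∀ i → 2 + i < n → P i (1 + i) (2 + i)) → P K (1 + K) 0 → P (1 + K) 0 1 →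
    ∀ i → P (toℕ (pos i)) (toℕ (pos (1 + i))) (toℕ (pos (2 + i)))
  cyclic-triples P inner last first i =
    subst₂ (λ v w → P (toℕ (pos i)) v w) (at 1) (at 2) (go r (toℕ<n (pos i)) refl)
    where
    r : ℕ
    r = toℕ (pos i)
    at : ∀ d → toℕ (pos (d + r)) ≡ toℕ (pos (d + i))
    at d = cong toℕ (pos-shift d (pos-toℕ (pos i)))
    0<n : 0 < n
    0<n = s≤s z≤n
    go : ∀ j → j < n → r ≡ j → P r (toℕ (pos (1 + r))) (toℕ (pos (2 + r)))
    go j j<n refl with m≤n⇒m<n∨m≡n j<n
    ... | inj₂ r≡N = subst (λ r → P r (toℕ (pos (1 + r))) (toℕ (pos (2 + r)))) (sym (suc-injective r≡N))
          (subst₂ (P (1 + K)) (sym (trans (cong toℕ (pos-n 0)) (toℕ-pos-< 0<n)))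
             (sym (trans (cong toℕ (pos-n 1)) (toℕ-pos-< (s≤s (s≤s z≤n))))) first)
    ... | inj₁ 1+r<n with m≤n⇒m<n∨m≡n 1+r<n
    ...   | inj₁ 2+r<n = subst₂ (P r) (sym (toℕ-pos-< 1+r<n)) (sym (toℕ-pos-< 2+r<n)) (inner r 2+r<n)
    ...   | inj₂ r≡K = subst (λ r → P r (toℕ (pos (1 + r))) (toℕ (pos (2 + r)))) (sym (suc-injective (suc-injective r≡K)))
          (subst₂ (P K) (sym (toℕ-pos-< ≤-refl))
             (sym (trans (cong toℕ (pos-n 0)) (toℕ-pos-< 0<n))) last)

  fromSequence : (g : ℕ → Fin 3) → (∀ i → suc i < n → g i ≢ g (suc i)) → g (suc K) ≢ g 0 → ProperColoring C 3
  fromSequence g step wrap = record { color = g ∘ toℕ ; proper = λ { (inj₁ nx) → next nx ; (inj₂ nx) → next nx ∘ sym } }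
    where
    next : ∀ {u v : Fin n} → Next u v → g (toℕ u) ≢ g (toℕ v)
    next {u} {v} (inj₁ e) gu≡gv = step (toℕ u) (subst (_< n) (sym e) (toℕ<n v)) (trans gu≡gv (cong g (sym e)))
    next (inj₂ (e , e₀)) gu≡gv = wrap (trans (cong g (sym (suc-injective e))) (trans gu≡gv (cong g e₀)))

  ForcedAt TightAt : (ℕ → Fin 3) → (ℕ → Bool) → ℕ → ℕ → ℕ → Set
  ForcedAt g f a b d = f b ≡ false → f a ≡ true × f d ≡ true × g a ≢ g d
  TightAt  g f a b d = f b ≡ true → g a ≢ g d → f a ≡ false ⊎ f d ≡ false

  module _ (g : ℕ → Fin 3) (f : ℕ → Bool) where
    private
      S : Subset n
      S = tabulate (f ∘ toℕ)
      at : ∀ v → lookup S v ≡ f (toℕ v)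
      at = lookup∘tabulate (f ∘ toℕ)

    tabulate-forced : (∀ i → ForcedAt g f (toℕ (pos i)) (toℕ (pos (1 + i))) (toℕ (pos (2 + i)))) →
      Forced (g ∘ toℕ) S
    tabulate-forced h i rewrite at (pos i) | at (pos (1 + i)) | at (pos (2 + i)) = h i

    tabulate-tight : (∀ i → TightAt g f (toℕ (pos i)) (toℕ (pos (1 + i))) (toℕ (pos (2 + i)))) →
      Tight (g ∘ toℕ) S
    tabulate-tight h i rewrite at (pos i) | at (pos (1 + i)) | at (pos (2 + i)) = h i

    ∣tabulate∣ : ∣ S ∣ ≡ ∑ (bit ∘ f) n
    ∣tabulate∣ = ∣∣-∑ S (bit ∘ f) (cong bit ∘ at)

  module _ (c : ProperColoring C 3) (S : Subset n) (crit : Critical C c S) where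
    private
      κ : ℕ → Fin 3
      κ = color c ∘ pos
      s : ℕ → ℕ
      s i = bit (lookup S (pos i))

    -- If the rainbow middle vertex is in the critical set, tightness puts one of its neighbours
    -- outside.
    triple-bound : ∀ i → κ i ≢ κ (2 + i) → s i + (s (1 + i) + s (2 + i)) ≤ 2
    triple-bound i rb with lookup S (pos (1 + i)) in e₁
    ... | false = +-mono-≤ (bit≤1 (lookup S (pos i))) (bit≤1 (lookup S (pos (2 + i))))
    ... | true with critical⇒tight c {S} crit i e₁ rb
    ...   | inj₁ e rewrite e = s≤s (bit≤1 _)
    ...   | inj₂ e rewrite e = +-monoˡ-≤ 1 (bit≤1 _)

    -- The non-rainbow vertex `1 + i` is in every critical set, so tightness at the rainbow vertex
    -- `2 + i` can only be met by omitting `3 + i`.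
    pair-bound : ∀ i → κ i ≡ κ (2 + i) → κ (1 + i) ≢ κ (3 + i) → s (2 + i) + s (3 + i) ≤ 1
    pair-bound i plain rb with lookup S (pos (2 + i)) in e₂
    ... | false = bit≤1 _
    ... | true with critical⇒tight c {S} crit (suc i) e₂ rb
    ...   | inj₁ e = contradiction plain (proj₂ (proj₂ (determining⇒forced c {S} (proj₁ crit) i e)))
    ...   | inj₂ e rewrite e = ≤-refl

  -- Two colors would alternate, giving the adjacent positions 0 and `m * 2` the same color.
  chromatic-≥3 : ∀ m → suc K ≡ m * 2 → ∀ {j} → ProperColoring C j → 3 ≤ j
  chromatic-≥3 m N≡m*2 {j} c = ≮⇒≥ λ j<3 → clash (s≤s⁻¹ j<3)
    where
    clash : j ≤ 2 → ⊥
    clash j≤2 = step (suc K) (trans (cong κ N≡m*2) (trans (κ-even m) (cong (λ v → inject≤ (color c v) j≤2) (sym (pos-n 0)))))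
      where
      -- Embedding the palette into `Fin 2` treats all sizes up to 2 at once.
      κ : ℕ → Fin 2
      κ i = inject≤ (color c (pos i)) j≤2
      step : ∀ i → κ i ≢ κ (suc i)
      step i e = proper c (pos-Adj i) (inject≤-injective j≤2 j≤2 _ _ e)
      κ-even : ∀ j → κ (j * 2) ≡ κ 0
      κ-even zero    = refl
      κ-even (suc j) = trans (sym (two-colors (step (j * 2)) (step (1 + j * 2)))) (κ-even j)

-- The values for the two residue classes.

lcs-3mod4 : ∀ t (3≤n : 3 ≤ 3 + t * 2 * 2) → IsLowerLcs (cycle (3 + t * 2 * 2) 3≤n) (2 + t * 2)
lcs-3mod4 t 3≤n =
  3 , (c , chromatic-≥3 (1 + t * 2) refl)
  , (c , (S , forced∧tight⇒critical c {S} S-forced S-tight , ∣S∣) , λ { (X , crit , refl) → upper X crit })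
  , λ { (c′ , (X , crit , refl) , _) →
        half (1 + t * 2) _ (forced⇒n≤2∣S∣ {color c′} {X} (determining⇒forced c′ {X} (proj₁ crit))) }
  where
  open ExplicitCycle (1 + t * 2 * 2) 3≤n
  k : ℕ
  k = t * 2
  c : ProperColoring C 3
  c = fromSequence pat (λ i _ → pat-suc i) λ e → contradiction (trans (sym (pat-2 t)) e) λ ()
  S : Subset n
  S = tabulate (alt ∘ toℕ)
  S-forced : Forced (color c) S
  S-forced = tabulate-forced pat alt (cyclic-triples (ForcedAt pat alt) (λ i _ → alt-forced i)
    (λ e → contradiction (trans (sym (alt-even k)) e) λ ()) λ ())
  S-tight : Tight (color c) S
  S-tight = tabulate-tight pat alt (cyclic-triples (TightAt pat alt) (λ i _ e rb → contradiction (alt-tight i e) rb)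
    -- The two vertices at the seam are rainbow too, so tightness comes from their neighbours
    -- `1 + k * 2` and 1, which are outside `S`.
    (λ _ _ → inj₁ (alt-odd k)) λ _ _ → inj₂ refl)
  ∣S∣ : ∣ S ∣ ≡ 2 + k
  ∣S∣ = trans (∣tabulate∣ pat alt) (cong (2 +_) (∑-pairs≡1 (λ i → bit (alt (1 + i))) k
    λ j → cong₂ _+_ (cong bit (alt-odd j)) (cong bit (alt-even j))))
  at : ∀ {i} → i < n → color c (pos i) ≡ pat i
  at i<n = cong pat (toℕ-pos-< i<n)
  -- The triple 0, 1, 2 around a rainbow vertex counts at most 2. The rest splits into pairs
  -- `3 + j * 2`, `4 + j * 2`, each preceded by a non-rainbow vertex.
  upper : ∀ X → Critical C c X → ∣ X ∣ ≤ 2 + k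
  upper X crit = subst (_≤ 2 + k) (sym (∣∣-pos X)) (head-bound (s 0) (s 1) (s 2)
    (triple-bound c X crit 0 (different (0<1+n) (s≤s (s≤s (s≤s z≤n))) λ ()))
    (∑-pairs≤1 (λ i → s (3 + i)) k pairs≤1))
    where
    s : ℕ → ℕ
    s i = bit (lookup X (pos i))
    different : ∀ {i j} → i < n → j < n → pat i ≢ pat j → color c (pos i) ≢ color c (pos j)
    different i<n j<n ne e = ne (trans (sym (at i<n)) (trans e (at j<n)))
    pairs≤1 : ∀ j → j < k → s (3 + j * 2) + s (4 + j * 2) ≤ 1
    pairs≤1 j j<k = pair-bound c X crit (1 + j * 2)
      (trans (at (<⇒≤ (<⇒≤ (<⇒≤ 4+2j<n)))) (trans (trans (pat-odd j) (sym (pat-odd (1 + j)))) (sym (at (<⇒≤ 4+2j<n)))))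
      (different (<⇒≤ (<⇒≤ 4+2j<n)) 4+2j<n (pat-even (1 + j)))
      where
      4+2j<n : 4 + j * 2 < n
      4+2j<n = +-monoʳ-≤ 3 (*-monoˡ-≤ 2 j<k)

lcs-1mod4 : ∀ t (3≤n : 3 ≤ 5 + t * 2 * 2) → IsLowerLcs (cycle (5 + t * 2 * 2) 3≤n) (4 + t * 2)
lcs-1mod4 t 3≤n =
  3 , (c , chromatic-≥3 (2 + t * 2) refl)
  , (c , (S , forced∧tight⇒critical c {S} S-forced S-tight , ∣S∣) , λ { (X , crit , refl) → upper X crit })
  , λ { (c′ , (X , crit , refl) , max) → lower c′ X crit λ T critᵀ → max (T , critᵀ , refl) }
  where
  open ExplicitCycle (3 + t * 2 * 2) 3≤n
  k : ℕ
  k = t * 2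
  -- The prefix 1, 2 makes the positions 1, 2, 3 a run of rainbow vertices and leaves both seam
  -- vertices non-rainbow.
  g : ℕ → Fin 3
  g 0 = suc zero
  g 1 = suc (suc zero)
  g (suc (suc i)) = pat i
  -- Of that run only the middle vertex is omitted, which gives one more element than omitting both
  -- ends.
  f : ℕ → Bool
  f 0 = true
  f 1 = true
  f 2 = false
  f 3 = true
  f (suc (suc (suc (suc i)))) = alt i
  g-suc : ∀ i → g i ≢ g (suc i)
  g-suc 0 ()
  g-suc 1 ()
  g-suc (suc (suc i)) = pat-suc i
  c : ProperColoring C 3
  c = fromSequence g (λ i _ → g-suc i) λ e → contradiction (trans (sym (pat-2 t)) e) λ ()
  S : Subset n
  S = tabulate (f ∘ toℕ)
  inner-forced : ∀ i → ForcedAt g f i (1 + i) (2 + i)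
  inner-forced 1 _ = refl , refl , λ ()
  inner-forced (suc (suc (suc (suc i)))) = alt-forced (2 + i)
  inner-forced 0 ()
  inner-forced 2 ()
  inner-forced 3 ()
  inner-tight : ∀ i → TightAt g f i (1 + i) (2 + i)
  inner-tight 0 _ _  = inj₂ refl
  inner-tight 2 _ _  = inj₁ refl
  inner-tight 3 _ rb = contradiction refl rb
  inner-tight (suc (suc (suc (suc i)))) e rb = contradiction (alt-tight (2 + i) e) rb
  S-forced : Forced (color c) S
  S-forced = tabulate-forced g f (cyclic-triples (ForcedAt g f) (λ i _ → inner-forced i)
    (λ e → contradiction (trans (sym (alt-even k)) e) λ ()) λ ())
  S-tight : Tight (color c) S
  S-tight = tabulate-tight g f (cyclic-triples (TightAt g f) (λ i _ → inner-tight i)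
    (λ _ rb → contradiction (pat-odd k) rb) λ _ rb → contradiction (pat-2 t) rb)
  ∣S∣ : ∣ S ∣ ≡ 4 + k
  ∣S∣ = trans (∣tabulate∣ g f) (cong (4 +_) (∑-pairs≡1 (λ i → bit (alt (1 + i))) k
    λ j → cong₂ _+_ (cong bit (alt-odd j)) (cong bit (alt-even j))))
  at : ∀ {i} → i < n → color c (pos i) ≡ g i
  at i<n = cong g (toℕ-pos-< i<n)
  -- Vertices 0 and 4 count at most 1 each, the triple 1, 2, 3 at most 2, and each of the `k`
  -- remaining pairs at most 1.
  upper : ∀ X → Critical C c X → ∣ X ∣ ≤ 4 + k
  upper X crit = subst (_≤ 4 + k) (sym (∣∣-pos X)) (+-mono-≤ (bit≤1 (lookup X (pos 0))) (head-bound (s 1) (s 2) (s 3)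
    (triple-bound c X crit 1 (different (s≤s (s≤s z≤n)) (s≤s (s≤s (s≤s (s≤s z≤n)))) λ ()))
    (+-mono-≤ (bit≤1 (lookup X (pos 4))) (∑-pairs≤1 (λ i → s (5 + i)) k pairs≤1))))
    where
    s : ℕ → ℕ
    s i = bit (lookup X (pos i))
    different : ∀ {i j} → i < n → j < n → g i ≢ g j → color c (pos i) ≢ color c (pos j)
    different i<n j<n ne e = ne (trans (sym (at i<n)) (trans e (at j<n)))
    pairs≤1 : ∀ j → j < k → s (5 + j * 2) + s (6 + j * 2) ≤ 1
    pairs≤1 j j<k = pair-bound c X crit (3 + j * 2)
      (trans (at (<⇒≤ (<⇒≤ (<⇒≤ 6+2j<n)))) (trans (trans (pat-odd j) (sym (pat-odd (1 + j)))) (sym (at (<⇒≤ 6+2j<n)))))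
      (different (<⇒≤ (<⇒≤ 6+2j<n)) 6+2j<n (pat-even (1 + j)))
      where
      6+2j<n : 6 + j * 2 < n
      6+2j<n = +-monoʳ-≤ 5 (*-monoˡ-≤ 2 j<k)
  -- Double counting gives only `3 + k`, which is (n + 1) / 2; the gap argument rules out equality.
  lower : ∀ c′ X → Critical C c′ X → (∀ T → Critical C c′ T → ∣ T ∣ ≤ ∣ X ∣) → 4 + k ≤ ∣ X ∣
  lower c′ X crit max = ≤∧≢⇒< (half (2 + k) _ (forced⇒n≤2∣S∣ {color c′} {X} (determining⇒forced c′ {X} (proj₁ crit))))
    λ 3+k≡∣X∣ → OneModFour.critical-suc-m-not-largest t 3≤n c′ X crit (sym 3+k≡∣X∣)
      λ T critᵀ → subst (∣ T ∣ ≤_) (sym 3+k≡∣X∣) (max T critᵀ)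

theorem10 : (n : ℕ) (3≤n : 3 ≤ n) → n % 2 ≡ 1 →
    (n % 4 ≡ 1 → IsLowerLcs (cycle n 3≤n) ((n + 3) / 2)) ×
    (n % 4 ≡ 3 → IsLowerLcs (cycle n 3≤n) ((n + 1) / 2))
theorem10 n 3≤n _ =
    (λ r → case₁ (n / 4) n 3≤n (decompose r))
  , (λ r → case₃ (n / 4) n 3≤n (decompose r))
  where
  decompose : ∀ {r} → n % 4 ≡ r → n ≡ r + n / 4 * 2 * 2
  decompose {r} n%4≡r = trans (m≡m%n+[m/n]*n n 4) (cong₂ _+_ n%4≡r (sym (*-assoc (n / 4) 2 2)))
  halve : ∀ a b c → (a + b * 2) + c ≡ (a + c) + b * 2
  halve a b c = trans (+-assoc a (b * 2) c) (trans (cong (a +_) (+-comm (b * 2) c)) (sym (+-assoc a c (b * 2))))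
  case₁ : ∀ q n (3≤n : 3 ≤ n) → n ≡ 1 + q * 2 * 2 → IsLowerLcs (cycle n 3≤n) ((n + 3) / 2)
  -- Quotient 0 would mean `n = 1`; a positive quotient `suc t` gives `5 + t * 2 * 2`.
  case₁ zero    _ (s≤s ()) refl
  case₁ (suc t) _ 3≤n refl = subst (IsLowerLcs (cycle _ 3≤n))
    (sym (trans (cong (_/ 2) (halve 5 (t * 2) 3)) (m*n/n≡m (4 + t * 2) 2))) (lcs-1mod4 t 3≤n)
  case₃ : ∀ q n (3≤n : 3 ≤ n) → n ≡ 3 + q * 2 * 2 → IsLowerLcs (cycle n 3≤n) ((n + 1) / 2)
  case₃ t _ 3≤n refl = subst (IsLowerLcs (cycle _ 3≤n))
    (sym (trans (cong (_/ 2) (halve 3 (t * 2) 1)) (m*n/n≡m (2 + t * 2) 2))) (lcs-3mod4 t 3≤n)
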